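{- Let $\mathcal{L}$ be a fragment of hybrid-dynamic quantum logic (HDQL) as described in the context. Assume that the signatures of $\mathcal{L}$ have no closed propositional symbols and that the actions of $\mathcal{L}$ are free of the operator $*$. Then the least entailment system of $\mathcal{L}$ closed under the basic proof rules, the necessity rules and the implication rules is compact; that is, for all signatures $\Delta$ of $\mathcal{L}$, all sets $\Gamma$ of $\Delta$-sentences, all $\Delta$-sentences $\gamma$ and all ground terms $k$ of sort vector, $\Gamma\vdash^k_\Delta\gamma$ implies $\Gamma_f\vdash^k_\Delta\gamma$ for some finite $\Gamma_f\subseteq\Gamma$.
   Context: **Hilbert spaces.** $\Sigma^{h}=(S^{h},F^{h},P^{h})$ is the two-sorted first-order signature with sorts $\mathsf{c}$ (scalars) and $\mathsf{v}$ (vectors), function symbols $F^{h}=F^{\mathsf{c}}\cup F^{\mathsf{v}}$, where $F^{\mathsf{c}}$ is a fixed set of the usual operations on complex numbers (addition, multiplication, etc.) and $F^{\mathsf{v}}$ consists of vector addition, the zero vector $0$, scalar multiplication and inner product $\langle\_\mid\_\rangle:\mathsf{v}\,\mathsf{v}\to\mathsf{c}$, and a single relation symbol $<$ on $\mathsf{c}$. A Hilbert space is a $\Sigma^{h}$-structure $\mathcal{H}$ with $\mathcal{H}_{\mathsf{c}}=\mathbb{C}$, $F^{\mathsf{c}}$ interpreted as usual, $<$ the usual strict order on real numbers, and $\mathcal{H}_{\mathsf{v}}$ with $F^{\mathsf{v}}$ a complete complex inner product space. **Signatures.** An HDQL signature is $\Delta=(\Sigma,E,\mathrm{Prop})$ where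 $\Sigma$ is $\Sigma^{h}$ extended with a set $U$ of unitary transformation symbols $u:\mathsf{v}\to\mathsf{v}$, a set $Q$ of projective measurement symbols $q:\mathsf{v}\to\mathsf{v}$, a set $D$ of constants of sort $\mathsf{v}$ and a set $C$ of constants of sort $\mathsf{c}$; $E$ is a set of first-order $\Sigma$-sentences; $\mathrm{Prop}$ is a set of propositional symbols with a distinguished subset $\mathrm{Prop}_c$ of closed propositional symbols. A signature morphism $\chi:\Delta_1\to\Delta_2$ consists of a first-order signature morphism $\chi:\Sigma_1\to\Sigma_2$ with $E_2\models\chi(E_1)$ that is the identity on $\Sigma^{h}$ and satisfies $\chi(U_1)\subseteq U_2$, $\chi(Q_1)\subseteq Q_2$, together with a map $\chi:\mathrm{Prop}_1\to\mathrm{Prop}_2$ sending closed propositional symbols to closed propositional symbols. It induces a symbol-wise translation of terms and sentences, also written $\chi$. **Sentences.** Actions: $\mathfrak{a}::=u\mid q\mid \mathfrak{a};\mathfrak{a}\mid\mathfrak{a}\cup\mathfrak{a}\mid\mathfrak{a}^*$ ($u\in U$, $q\in Q$). Sentences: $\gamma::=p\mid @_k\gamma\mid\gamma\wedge\gamma\mid\neg\gamma\mid\;\sim\gamma\mid[\mathfrak{a}]\gamma\mid{\downarrow}z\cdot\gamma$, where $p\in\mathrm{Prop}$, $k$ is a term of sort $\mathsf{v}$, $\mathfrak{a}$ is an action, $z$ is a variable of sort $\mathsf{v}$ (which may be used as an additional vector constant inside $\gamma$ in ${\downarrow}z\cdot\gamma$). Classical implication is written $\varphi\Rightarrow\gamma$.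 Closed sentences: $\rho::=r\mid\;\sim\rho\mid\rho\wedge\rho\mid[\mathfrak{b}]\rho$, with $r\in\mathrm{Prop}_c$ and $\mathfrak{b}$ an action containing no measurement symbol. For closed sentences, quantum implication (Sasaki hook) is $\rho_1\leadsto\rho_2:=\;\sim(\rho_1\wedge\sim(\rho_1\wedge\rho_2))$. **Basic sentences and quantum clauses.** Basic sentences: $\varphi::=p\mid\varphi\wedge\varphi\mid @_k\varphi\mid[\mathfrak{a}]\varphi\mid{\downarrow}z\cdot\varphi$. Quantum clauses: $\gamma::=p\mid\rho_1\leadsto\rho_2\mid\varphi\Rightarrow\gamma\mid\gamma\wedge\gamma\mid @_k\gamma\mid[\mathfrak{a}]\gamma\mid{\downarrow}z\cdot\gamma$, where $\rho_1$ is a closed sentence that is basic, $\rho_2$ is a closed sentence that is a quantum clause, and $\varphi$ is basic. **The fragment $\mathcal{L}$.** Let $\Sigma$ be $\Sigma^{h}$ extended only with sets $U,Q$, and let $\mathcal{W}$ be a $\Sigma$-structure whose $\Sigma^{h}$-reduct is a Hilbert space, with each $u^{\mathcal{W}}$ a unitary operator and each $q^{\mathcal{W}}$ a projective measurement, i.e. there is a closed subspace $\mathcal{X}\subseteq\mathcal{W}_{\mathsf{v}}$ with orthogonal projection $P_{\mathcal{X}}$ such that $q^{\mathcal{W}}(w)=P_{\mathcal{X}}(w)/\sqrt{\langle w\mid P_{\mathcal{X}}(w)\rangle}$ for all $w$ (read as $0$ if $P_{\mathcal{X}}(w)=0$). $\Sigma_{\mathcal{W}}$ is $\Sigma$ with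 all vectors of $\mathcal{W}$ added as constants of sort $\mathsf{v}$ and all complex numbers added as constants of sort $\mathsf{c}$; $\mathcal{W}_{\mathcal{W}}$ is the expansion of $\mathcal{W}$ interpreting each such constant as itself; $E_{\mathcal{W}}$ is the set of ground equations and ground relational atoms over $\Sigma_{\mathcal{W}}$ true in $\mathcal{W}_{\mathcal{W}}$. $\mathcal{L}$ is an arbitrary fragment of HDQL (obtained by restricting signatures and possibly discarding some sentence or action operators, including $\Rightarrow$ and $\leadsto$, which are treated as operators) such that all its signatures have the form $\Delta_{\mathcal{W}}=(\Sigma_{\mathcal{W}},E_{\mathcal{W}},\mathrm{Prop})$, and retrieve $@$ belongs to $\mathcal{L}$ whenever $\Rightarrow$ or $\leadsto$ does. Signature morphisms of $\mathcal{L}$ are the identity on complex numbers. **Entailment systems.** An entailment system of $\mathcal{L}$ is a family of relations $\vdash^k_\Delta$ between sets of $\Delta$-sentences and $\Delta$-sentences (for $\Delta$ a signature of $\mathcal{L}$ and $k$ a ground term of sort $\mathsf{v}$) satisfying: (Monotonicity) $\Gamma\vdash^k\gamma$ if $\gamma\in\Gamma$; (Unions) $\Gamma\vdash^k\gamma$ implies $\Gamma\cup\Gamma'\vdash^k\gamma$; (Translation) $\Gamma\vdash^k\gamma$ implies $\chi(\Gamma)\vdash^{\chi(k)}\chi(\gamma)$ for each signature morphism $\chi$ of $\mathcal{L}$. No cut rule is assumed. **Proof rules** (over a signature $\Delta_{\mathcal{W}}$; for sentences of $\mathcal{L}$). *Basic rules*: from $\Gamma\vdash^{k_1}\gamma$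 infer $\Gamma\vdash^{k_2}\gamma$ for each equation $k_1=k_2$ in $E_{\mathcal{W}}$; $\Gamma\vdash^{k_1}\gamma$ and $\Gamma\vdash^{k_2}@_{k_1}\gamma$ are inferable from each other; $\Gamma\vdash^k\gamma[z\leftarrow k]$ (substitute $k$ for $z$) and $\Gamma\vdash^k{\downarrow}z\cdot\gamma$ are inferable from each other; from $\Gamma\vdash^k\gamma_1$ and $\Gamma\vdash^k\gamma_2$ infer $\Gamma\vdash^k\gamma_1\wedge\gamma_2$; from $\Gamma\vdash^k\gamma_1\wedge\gamma_2$ infer $\Gamma\vdash^k\gamma_i$ ($i=1,2$). *Necessity rules* (the rules for $*$ do not apply, since actions are $*$-free): for $f\in U\cup Q$, $\Gamma\vdash^{f(k)}\gamma$ and $\Gamma\vdash^k[f]\gamma$ are inferable from each other; $\Gamma\vdash^k[\mathfrak{a}_1;\mathfrak{a}_2]\gamma$ and $\Gamma\vdash^k[\mathfrak{a}_1][\mathfrak{a}_2]\gamma$ are inferable from each other; from $\Gamma\vdash^k[\mathfrak{a}_1]\gamma$ and $\Gamma\vdash^k[\mathfrak{a}_2]\gamma$ infer $\Gamma\vdash^k[\mathfrak{a}_1\cup\mathfrak{a}_2]\gamma$; from $\Gamma\vdash^k[\mathfrak{a}_1\cup\mathfrak{a}_2]\gamma$ infer $\Gamma\vdash^k[\mathfrak{a}_i]\gamma$ ($i=1,2$). *Implication rules* ($\varphi$ basic, $\rho_1$ closed basic, $\rho_2$ closed quantum clause): from $\Gamma\vdash^k\varphi\Rightarrow\gamma$ and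 $\Gamma\vdash^k\varphi$ infer $\Gamma\vdash^k\gamma$; from $\Gamma\vdash^k\rho_1\leadsto\rho_2$ and $\Gamma\vdash^k\rho_1$ infer $\Gamma\vdash^k\rho_2$; from $\Gamma\cup\{@_k\varphi\}\vdash^k\gamma$ infer $\Gamma\vdash^k\varphi\Rightarrow\gamma$; from $\Gamma\cup\{@_k\rho_1\}\vdash^k\rho_2$ infer $\Gamma\vdash^k\rho_1\leadsto\rho_2$. -}

module Defs where

open import Level using (Level; 0ℓ) renaming (suc to lsuc)
open import Algebra.Apartness.Bundles using (HeytingField)
open import Algebra.Bundles using (AbelianGroup; CommutativeRing)
open import Algebra.Module.Bundles using (LeftModule)
open import Algebra.Module.Morphism.Structures using (module LeftModuleMorphisms)
import Algebra.Construct.DirectProduct as DirectProduct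
import Algebra.Definitions.RawMonoid as RawMonoidDefinitions
import Algebra.Properties.Ring as RingProperties
import Algebra.Solver.Ring.NaturalCoefficients.Default as SemiringSolver
open import Data.Fin.Base using (Fin; zero; suc)
open import Data.List.Base using (List; []; _∷_; replicate)
import Data.List.Membership.Propositional as List
open import Data.List.Relation.Unary.All using (All; []; _∷_)
open import Data.Nat.Base as ℕ using (ℕ; zero; suc)
open import Data.Product.Base using (_×_; _,_; proj₁; proj₂; ∃; ∃-syntax)
open import Data.Sum.Base using (_⊎_)
open import Data.Unit.Polymorphic.Base using (⊤; tt)
open import Data.Vec.Base using (Vec; []; _∷_)
open import Data.Vec.Relation.Binary.Pointwise.Inductive using (Pointwise; []; _∷_)
open import Function.Base using (_∘_)
open import Function.Bundles using (_⇔_)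
open import Relation.Binary.Bundles using (Setoid)
open import Relation.Binary.Core using (Rel)
open import Relation.Binary.PropositionalEquality using (_≡_)
open import Relation.Binary.Structures using (IsStrictPartialOrder)
open import Relation.Nullary.Negation using (¬_)
open import Relation.Unary using (Pred; _∈_; _⊆_; _∪_; _≐_; ｛_｝)

------------------------------------------------------------------------
-- Real and complex numbers

-- The reals, characterised up to isomorphism as the Archimedean,
-- Cauchy-complete ordered field.  Equality is a setoid equality, so
-- that both a classical ℝ with _≡_ and the Cauchy reals are instances.

record RealNumbers (ℓ : Level) : Set (lsuc ℓ) where
  field
    heytingField : HeytingField ℓ ℓ ℓ
  open HeytingField heytingField public
    using (Carrier; _≈_; _#_; _+_; _*_; -_; 0#; 1#; _-_; isCommutativeRing)

  commutativeRing : CommutativeRing ℓ ℓ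
  commutativeRing = record { isCommutativeRing = isCommutativeRing }

  open RawMonoidDefinitions (CommutativeRing.+-rawMonoid commutativeRing) public
    using () renaming (_×_ to _×ⁿ_)

  infix 4 _<_ _≤_
  field
    _<_                  : Rel Carrier ℓ
    isStrictPartialOrder : IsStrictPartialOrder _≈_ _<_
    #⇔<⊎>                : ∀ {x y} → (x # y) ⇔ (x < y ⊎ y < x)
    +-monoˡ-<            : ∀ z {x y} → x < y → x + z < y + z
    *-pos                : ∀ {x y} → 0# < x → 0# < y → 0# < x * y
    archimedean          : ∀ x → ∃[ n ] x < n ×ⁿ 1#

  _≤_ : Rel Carrier ℓ
  x ≤ y = ¬ (y < x)

  Close : Carrier → Carrier → Carrier → Set ℓ
  Close ε x y = (x - y < ε) × (y - x < ε)

  Cauchy : (ℕ → Carrier) → Set ℓ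
  Cauchy s = ∀ ε → 0# < ε →
    ∃[ N ] ∀ m n → N ℕ.≤ m → N ℕ.≤ n → Close ε (s m) (s n)

  _⟶_ : (ℕ → Carrier) → Carrier → Set ℓ
  s ⟶ l = ∀ ε → 0# < ε → ∃[ N ] ∀ n → N ℕ.≤ n → Close ε (s n) l

  field
    complete : ∀ s → Cauchy s → ∃[ l ] s ⟶ l

module Complex {ℓ} (R : RealNumbers ℓ) where

  private module R = RealNumbers R
  open R using (_+_; _*_; -_; 0#; 1#) renaming (Carrier to ℝ) public

  ℂ : Set ℓ
  ℂ = ℝ × ℝ

  re im : ℂ → ℝ
  re = proj₁
  im = proj₂

  _*ᶜ_ : ℂ → ℂ → ℂ
  (a , b) *ᶜ (c , d) = (a * c + - (b * d)) , (a * d + b * c)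

  conjugate : ℂ → ℂ
  conjugate (a , b) = a , - b

  real : ℝ → ℂ
  real a = a , 0#

  private
    open CommutativeRing R.commutativeRing using
      ( _≈_; sym; trans; refl; ring; commutativeSemiring; +-abelianGroup
      ; +-cong; *-cong; -‿cong; +-congˡ )
    open SemiringSolver commutativeSemiring using (solve; _:=_; _:+_; _:*_; con)

    module ℂ⁺ = AbelianGroup (DirectProduct.abelianGroup +-abelianGroup +-abelianGroup)
    open ℂ⁺ using () renaming (_≈_ to _≈ᶜ_; _∙_ to _+ᶜ_; trans to transᶜ; sym to symᶜ; ∙-cong to +ᶜ-cong)

    -- The semiring solver treats −1 as an atom n; the laws below hold
    -- for every n, i.e. in R[x]/(x² − n).

    n : ℝ
    n = - 1#

    _⊛_ : ℂ → ℂ → ℂ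
    (a , b) ⊛ (c , d) = (a * c + n * (b * d)) , (a * d + b * c)

    ⊛≈* : ∀ x y → (x ⊛ y) ≈ᶜ (x *ᶜ y)
    ⊛≈* (a , b) (c , d) = +-congˡ (RingProperties.-1*x≈-x ring (b * d)) , refl

    *ᶜ-cong : ∀ {x y u v} → x ≈ᶜ y → u ≈ᶜ v → (x *ᶜ u) ≈ᶜ (y *ᶜ v)
    *ᶜ-cong (p , q) (r , s) =
      +-cong (*-cong p r) (-‿cong (*-cong q s)) , +-cong (*-cong p s) (*-cong q r)

    ⊛-assoc : ∀ x y z → ((x ⊛ y) ⊛ z) ≈ᶜ (x ⊛ (y ⊛ z))
    ⊛-assoc (a , b) (c , d) (e , f) =
      solve 7 (λ n a b c d e f →
        (a :* c :+ n :* (b :* d)) :* e :+ n :* ((a :* d :+ b :* c) :* f) :=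
        a :* (c :* e :+ n :* (d :* f)) :+ n :* (b :* (c :* f :+ d :* e)))
        refl n a b c d e f ,
      solve 7 (λ n a b c d e f →
        (a :* c :+ n :* (b :* d)) :* f :+ (a :* d :+ b :* c) :* e :=
        a :* (c :* f :+ d :* e) :+ b :* (c :* e :+ n :* (d :* f)))
        refl n a b c d e f

    *ᶜ-assoc : ∀ x y z → ((x *ᶜ y) *ᶜ z) ≈ᶜ (x *ᶜ (y *ᶜ z))
    *ᶜ-assoc x y z =
      transᶜ (*ᶜ-cong (symᶜ (⊛≈* x y)) ℂ⁺.refl) (transᶜ (symᶜ (⊛≈* (x ⊛ y) z))
      (transᶜ (⊛-assoc x y z)
      (transᶜ (⊛≈* x (y ⊛ z)) (*ᶜ-cong (ℂ⁺.refl {x}) (⊛≈* y z)))))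

    *ᶜ-comm : ∀ x y → (x *ᶜ y) ≈ᶜ (y *ᶜ x)
    *ᶜ-comm x@(a , b) y@(c , d) =
      transᶜ (symᶜ (⊛≈* x y)) (transᶜ
      ( solve 5 (λ n a b c d →
          a :* c :+ n :* (b :* d) := c :* a :+ n :* (d :* b)) refl n a b c d
      , solve 4 (λ a b c d →
          a :* d :+ b :* c := c :* b :+ d :* a) refl a b c d )
      (⊛≈* y x))

    *ᶜ-identityˡ : ∀ x → (real 1# *ᶜ x) ≈ᶜ x
    *ᶜ-identityˡ x@(a , b) = transᶜ (symᶜ (⊛≈* (real 1#) x))
      ( solve 3 (λ n a b → con 1 :* a :+ n :* (con 0 :* b) := a) refl n a b
      , solve 2 (λ a b → con 1 :* b :+ con 0 :* a := b) refl a b )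

    *ᶜ-distribˡ : ∀ x y z → (x *ᶜ (y +ᶜ z)) ≈ᶜ ((x *ᶜ y) +ᶜ (x *ᶜ z))
    *ᶜ-distribˡ x@(a , b) y@(c , d) z@(e , f) =
      transᶜ (symᶜ (⊛≈* x (y +ᶜ z))) (transᶜ
      ( solve 7 (λ n a b c d e f →
          a :* (c :+ e) :+ n :* (b :* (d :+ f)) :=
          (a :* c :+ n :* (b :* d)) :+ (a :* e :+ n :* (b :* f)))
          refl n a b c d e f
      , solve 6 (λ a b c d e f →
          a :* (d :+ f) :+ b :* (c :+ e) :=
          (a :* d :+ b :* c) :+ (a :* f :+ b :* e))
          refl a b c d e f )
      (+ᶜ-cong (⊛≈* x y) (⊛≈* x z)))

  ℂ-commutativeRing : CommutativeRing ℓ ℓ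
  ℂ-commutativeRing = record
    { _*_ = _*ᶜ_
    ; 1#  = real 1#
    ; isCommutativeRing = record
      { isRing = record
        { +-isAbelianGroup = ℂ⁺.isAbelianGroup
        ; *-cong     = *ᶜ-cong
        ; *-assoc    = *ᶜ-assoc
        ; *-identity = *ᶜ-identityˡ ,
            λ x → transᶜ (*ᶜ-comm x (real 1#)) (*ᶜ-identityˡ x)
        ; distrib    = *ᶜ-distribˡ ,
            λ x y z → transᶜ (*ᶜ-comm (y +ᶜ z) x) (transᶜ (*ᶜ-distribˡ x y z)
              (+ᶜ-cong (*ᶜ-comm x y) (*ᶜ-comm x z)))
        }
      ; *-comm = *ᶜ-comm
      }
    }

  open CommutativeRing ℂ-commutativeRing public
    using () renaming (_≈_ to _≈ᶜ_; _+_ to _+ᶜ_; 0# to 0ᶜ; ring to ℂ-ring)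

  infix 4 _<ᶜ_
  _<ᶜ_ : Rel ℂ ℓ
  z <ᶜ w = (im z R.≈ 0#) × (im w R.≈ 0#) × (re z R.< re w)

-- The operations of the fixed set Fᶜ other than addition and
-- multiplication: any finitary operations on ℂ (partial ones such as
-- the inverse made total by convention).

record ScalarOperations {ℓ} (R : RealNumbers ℓ) : Set (lsuc ℓ) where
  open Complex R
  field
    Op       : ℕ → Set ℓ
    apply    : ∀ {n} → Op n → Vec ℂ n → ℂ
    apply-cong : ∀ {n} (o : Op n) {xs ys} →
      Pointwise _≈ᶜ_ xs ys → apply o xs ≈ᶜ apply o ys

------------------------------------------------------------------------
-- Hilbert spaces and their operators

module Hilbert {ℓ} (R : RealNumbers ℓ) where

  open Complex R
  private module R = RealNumbers R

  record HilbertSpace : Set (lsuc ℓ) where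
    field
      leftModule : LeftModule ℂ-ring ℓ ℓ
    open LeftModule leftModule public
      renaming (Carrierᴹ to V)
      using (_≈ᴹ_; _+ᴹ_; _*ₗ_; 0ᴹ; -ᴹ_; rawLeftModule; ≈ᴹ-setoid; +ᴹ-cong; *ₗ-cong)
    field
      ⟨_∣_⟩      : V → V → ℂ
      ⟨∣⟩-cong   : ∀ {x x′ y y′} → x ≈ᴹ x′ → y ≈ᴹ y′ → ⟨ x ∣ y ⟩ ≈ᶜ ⟨ x′ ∣ y′ ⟩
      ⟨∣⟩-conj   : ∀ x y → ⟨ x ∣ y ⟩ ≈ᶜ conjugate ⟨ y ∣ x ⟩
      ⟨∣⟩-+      : ∀ x y z → ⟨ x ∣ y +ᴹ z ⟩ ≈ᶜ (⟨ x ∣ y ⟩ +ᶜ ⟨ x ∣ z ⟩)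
      ⟨∣⟩-*      : ∀ x a y → ⟨ x ∣ a *ₗ y ⟩ ≈ᶜ (a *ᶜ ⟨ x ∣ y ⟩)
      ⟨∣⟩-nonneg : ∀ x → 0# R.≤ re ⟨ x ∣ x ⟩
      ⟨∣⟩-def    : ∀ x → ⟨ x ∣ x ⟩ ≈ᶜ 0ᶜ → x ≈ᴹ 0ᴹ

    _-ᴹ_ : V → V → V
    x -ᴹ y = x +ᴹ (-ᴹ y)

    -- ‖x − y‖ < ε, squared to avoid the square root

    Close : ℝ → V → V → Set ℓ
    Close ε x y = re ⟨ x -ᴹ y ∣ x -ᴹ y ⟩ R.< ε * ε

    Cauchy : (ℕ → V) → Set ℓ
    Cauchy s = ∀ ε → 0# R.< ε →
      ∃[ N ] ∀ m n → N ℕ.≤ m → N ℕ.≤ n → Close ε (s m) (s n)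

    _⟶_ : (ℕ → V) → V → Set ℓ
    s ⟶ l = ∀ ε → 0# R.< ε → ∃[ N ] ∀ n → N ℕ.≤ n → Close ε (s n) l

    field
      complete : ∀ s → Cauchy s → ∃[ l ] s ⟶ l

  module _ (H : HilbertSpace) where
    open HilbertSpace H

    record IsUnitary (u : V → V) : Set ℓ where
      open LeftModuleMorphisms rawLeftModule rawLeftModule
      field
        isLinearIsomorphism : IsLeftModuleIsomorphism u
        preserves-⟨∣⟩       : ∀ x y → ⟨ u x ∣ u y ⟩ ≈ᶜ ⟨ x ∣ y ⟩
      open IsLeftModuleIsomorphism isLinearIsomorphism public using (⟦⟧-cong)

    record ClosedSubspace : Set (lsuc ℓ) where
      field
        X       : Pred V ℓ
        X-resp  : ∀ {x y} → x ≈ᴹ y → x ∈ X → y ∈ X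
        X-0     : 0ᴹ ∈ X
        X-+     : ∀ {x y} → x ∈ X → y ∈ X → (x +ᴹ y) ∈ X
        X-*     : ∀ a {x} → x ∈ X → (a *ₗ x) ∈ X
        X-limit : ∀ s {l} → (∀ n → s n ∈ X) → s ⟶ l → l ∈ X

    -- Where P w is not 0, q w is characterised by r q(w) = P w, with r
    -- the positive square root of ⟨w ∣ P w⟩.

    record IsProjectiveMeasurement (q : V → V) : Set (lsuc ℓ) where
      field
        subspace : ClosedSubspace
      open ClosedSubspace subspace public
      field
        P            : V → V
        P-in         : ∀ w → P w ∈ X
        P-orthogonal : ∀ w {x} → x ∈ X → ⟨ x ∣ w -ᴹ P w ⟩ ≈ᶜ 0ᶜ
        q-cong       : ∀ {v w} → v ≈ᴹ w → q v ≈ᴹ q w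
        q-zero       : ∀ w → P w ≈ᴹ 0ᴹ → q w ≈ᴹ 0ᴹ
        q-nonzero    : ∀ w → ¬ (P w ≈ᴹ 0ᴹ) →
          ∃[ r ] (0# R.< r) × (real (r * r) ≈ᶜ ⟨ w ∣ P w ⟩) × ((real r *ₗ q w) ≈ᴹ P w)

module HDQL {ℓ} (R : RealNumbers ℓ) (Fᶜ : ScalarOperations R) where

  open Complex R
  open Hilbert R
  open ScalarOperations Fᶜ

------------------------------------------------------------------------
-- First-order signatures extending the signature of Hilbert spaces

  data Sort : Set where
    𝕔 𝕧 : Sort

  record FOSignature : Set (lsuc ℓ) where
    field
      U Q D C : Set ℓ
  open FOSignature

  data Fun (Σ : FOSignature) : List Sort → Sort → Set ℓ where
    addᶜ mulᶜ : Fun Σ (𝕔 ∷ 𝕔 ∷ []) 𝕔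
    op        : ∀ {n} → Op n → Fun Σ (replicate n 𝕔) 𝕔
    addᵛ      : Fun Σ (𝕧 ∷ 𝕧 ∷ []) 𝕧
    zeroᵛ     : Fun Σ [] 𝕧
    scale     : Fun Σ (𝕔 ∷ 𝕧 ∷ []) 𝕧
    inner     : Fun Σ (𝕧 ∷ 𝕧 ∷ []) 𝕔
    unitary   : U Σ → Fun Σ (𝕧 ∷ []) 𝕧
    measure   : Q Σ → Fun Σ (𝕧 ∷ []) 𝕧
    vector    : D Σ → Fun Σ [] 𝕧
    scalar    : C Σ → Fun Σ [] 𝕔

  -- Terms with n (de Bruijn) variables, all of sort 𝕧

  data Term (Σ : FOSignature) (n : ℕ) : Sort → Set ℓ where
    var : Fin n → Term Σ n 𝕧
    app : ∀ {ws s} → Fun Σ ws s → All (Term Σ n) ws → Term Σ n s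

  data Atom (Σ : FOSignature) : Set ℓ where
    _≈ᵃ_ : ∀ {s} → Term Σ 0 s → Term Σ 0 s → Atom Σ
    _<ᵃ_ : Term Σ 0 𝕔 → Term Σ 0 𝕔 → Atom Σ

  EqualArgs : (S : Sort → Setoid ℓ ℓ) → ∀ {ws} → Rel (All (Setoid.Carrier ∘ S) ws) ℓ
  EqualArgs S []       []       = ⊤
  EqualArgs S (x ∷ xs) (y ∷ ys) = Setoid._≈_ (S _) x y × EqualArgs S xs ys

  record Structure (Σ : FOSignature) : Set (lsuc ℓ) where
    field
      sort : Sort → Setoid ℓ ℓ
    ∣_∣ : Sort → Set ℓ
    ∣ s ∣ = Setoid.Carrier (sort s)
    field
      fun      : ∀ {ws s} → Fun Σ ws s → All ∣_∣ ws → ∣ s ∣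
      fun-cong : ∀ {ws s} (f : Fun Σ ws s) {xs ys} → EqualArgs sort xs ys →
                 Setoid._≈_ (sort s) (fun f xs) (fun f ys)
      less     : Rel ∣ 𝕔 ∣ ℓ
      less-cong : ∀ {x x′ y y′} → Setoid._≈_ (sort 𝕔) x x′ →
                  Setoid._≈_ (sort 𝕔) y y′ → less x y → less x′ y′

    mutual
      eval : ∀ {s} → Term Σ 0 s → ∣ s ∣
      eval (app f ts) = fun f (evalAll ts)

      evalAll : ∀ {ws} → All (Term Σ 0) ws → All ∣_∣ ws
      evalAll []       = []
      evalAll (t ∷ ts) = eval t ∷ evalAll ts

  infix 4 _⊨_
  _⊨_ : ∀ {Σ} → Structure Σ → Atom Σ → Set ℓ
  M ⊨ (t ≈ᵃ t′) = let open Structure M in Setoid._≈_ (sort _) (eval t) (eval t′)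
  M ⊨ (t <ᵃ t′) = let open Structure M in less (eval t) (eval t′)

  _⊨ᴱ_ : ∀ {Σ} → Pred (Atom Σ) ℓ → Pred (Atom Σ) ℓ → Set (lsuc ℓ)
  _⊨ᴱ_ {Σ} E E′ = (M : Structure Σ) → (∀ {e} → e ∈ E → M ⊨ e) → (∀ {e} → e ∈ E′ → M ⊨ e)

  -- Identity on the signature of Hilbert spaces.  Added constants may
  -- be sent to any constant of the same sort, including the zero vector.

  record FOMorphism (Σ₁ Σ₂ : FOSignature) : Set ℓ where
    field
      onU : U Σ₁ → U Σ₂
      onQ : Q Σ₁ → Q Σ₂
      onD : D Σ₁ → Fun Σ₂ [] 𝕧
      onC : C Σ₁ → Fun Σ₂ [] 𝕔

    onFun : ∀ {ws s} → Fun Σ₁ ws s → Fun Σ₂ ws s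
    onFun addᶜ        = addᶜ
    onFun mulᶜ        = mulᶜ
    onFun (op o)      = op o
    onFun addᵛ        = addᵛ
    onFun zeroᵛ       = zeroᵛ
    onFun scale       = scale
    onFun inner       = inner
    onFun (unitary u) = unitary (onU u)
    onFun (measure q) = measure (onQ q)
    onFun (vector d)  = onD d
    onFun (scalar c)  = onC c

    mutual
      onTerm : ∀ {n s} → Term Σ₁ n s → Term Σ₂ n s
      onTerm (var z)    = var z
      onTerm (app f ts) = app (onFun f) (onTerms ts)

      onTerms : ∀ {n ws} → All (Term Σ₁ n) ws → All (Term Σ₂ n) ws
      onTerms []       = []
      onTerms (t ∷ ts) = onTerm t ∷ onTerms ts

    onAtom : Atom Σ₁ → Atom Σ₂
    onAtom (t ≈ᵃ t′) = onTerm t ≈ᵃ onTerm t′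
    onAtom (t <ᵃ t′) = onTerm t <ᵃ onTerm t′

  Image : {A B : Set ℓ} → (A → B) → Pred A ℓ → Pred B ℓ
  Image f S y = ∃[ x ] x ∈ S × y ≡ f x

  mutual
    substTerm : ∀ {Σ m n s} → (Fin m → Term Σ n 𝕧) → Term Σ m s → Term Σ n s
    substTerm σ (var z)    = σ z
    substTerm σ (app f ts) = app f (substTerms σ ts)

    substTerms : ∀ {Σ m n ws} → (Fin m → Term Σ n 𝕧) → All (Term Σ m) ws → All (Term Σ n) ws
    substTerms σ []       = []
    substTerms σ (t ∷ ts) = substTerm σ t ∷ substTerms σ ts

  extend : ∀ {Σ m n} → (Fin m → Term Σ n 𝕧) → Fin (suc m) → Term Σ (suc n) 𝕧
  extend σ zero    = var zero
  extend σ (suc z) = substTerm (var ∘ suc) (σ z)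

------------------------------------------------------------------------
-- The structures 𝒲 and the signatures Δ_𝒲

  record QuantumStructure : Set (lsuc ℓ) where
    field
      𝒰 𝒬          : Set ℓ
      hilbertSpace : HilbertSpace
    open HilbertSpace hilbertSpace public
    field
      ⟦_⟧ᵁ          : 𝒰 → V → V
      isUnitary     : ∀ u → IsUnitary hilbertSpace ⟦ u ⟧ᵁ
      ⟦_⟧ᵠ          : 𝒬 → V → V
      isMeasurement : ∀ q → IsProjectiveMeasurement hilbertSpace ⟦ q ⟧ᵠ

    -- Every vector and every complex number is a constant, so ≈-equal
    -- elements may be distinct constants; E identifies them.

    signature : FOSignature
    signature = record { U = 𝒰 ; Q = 𝒬 ; D = V ; C = ℂ }

    private
      S : Sort → Setoid ℓ ℓ
      S 𝕔 = CommutativeRing.setoid ℂ-commutativeRing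
      S 𝕧 = ≈ᴹ-setoid

      toVec : ∀ n → All (Setoid.Carrier ∘ S) (replicate n 𝕔) → Vec ℂ n
      toVec zero    []       = []
      toVec (suc n) (z ∷ zs) = z ∷ toVec n zs

      toVec-cong : ∀ n {xs ys} → EqualArgs S xs ys → Pointwise _≈ᶜ_ (toVec n xs) (toVec n ys)
      toVec-cong zero    {[]}    {[]}    tt       = []
      toVec-cong (suc n) {_ ∷ _} {_ ∷ _} (p , ps) = p ∷ toVec-cong n ps

      F : ∀ {ws s} → Fun signature ws s → All (Setoid.Carrier ∘ S) ws → Setoid.Carrier (S s)
      F addᶜ        (z ∷ w ∷ []) = z +ᶜ w
      F mulᶜ        (z ∷ w ∷ []) = z *ᶜ w
      F (op {n} o)  zs           = apply o (toVec n zs)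
      F addᵛ        (v ∷ w ∷ []) = v +ᴹ w
      F zeroᵛ       []           = 0ᴹ
      F scale       (z ∷ v ∷ []) = z *ₗ v
      F inner       (v ∷ w ∷ []) = ⟨ v ∣ w ⟩
      F (unitary u) (v ∷ [])     = ⟦ u ⟧ᵁ v
      F (measure q) (v ∷ [])     = ⟦ q ⟧ᵠ v
      F (vector v)  []           = v
      F (scalar z)  []           = z

      F-cong : ∀ {ws s} (f : Fun signature ws s) {xs ys} → EqualArgs S xs ys →
               Setoid._≈_ (S s) (F f xs) (F f ys)
      F-cong addᶜ        {_ ∷ _ ∷ []} {_ ∷ _ ∷ []} (p , q , tt) =
        CommutativeRing.+-cong ℂ-commutativeRing p q
      F-cong mulᶜ        {_ ∷ _ ∷ []} {_ ∷ _ ∷ []} (p , q , tt) =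
        CommutativeRing.*-cong ℂ-commutativeRing p q
      F-cong (op {n} o)  ps                                     = apply-cong o (toVec-cong n ps)
      F-cong addᵛ        {_ ∷ _ ∷ []} {_ ∷ _ ∷ []} (p , q , tt) = +ᴹ-cong p q
      F-cong zeroᵛ       {[]}         {[]}         tt           = Setoid.refl (S 𝕧)
      F-cong scale       {_ ∷ _ ∷ []} {_ ∷ _ ∷ []} (p , q , tt) = *ₗ-cong p q
      F-cong inner       {_ ∷ _ ∷ []} {_ ∷ _ ∷ []} (p , q , tt) = ⟨∣⟩-cong p q
      F-cong (unitary u) {_ ∷ []}     {_ ∷ []}     (p , tt)     = IsUnitary.⟦⟧-cong (isUnitary u) p
      F-cong (measure q) {_ ∷ []}     {_ ∷ []}     (p , tt)     =
        IsProjectiveMeasurement.q-cong (isMeasurement q) p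
      F-cong (vector v)  {[]}         {[]}         tt           = Setoid.refl (S 𝕧)
      F-cong (scalar z)  {[]}         {[]}         tt           = Setoid.refl (S 𝕔)

    structure : Structure signature
    structure = record
      { sort = S
      ; fun = F
      ; fun-cong = F-cong
      ; less = _<ᶜ_
      ; less-cong = λ (p , p′) (q , q′) (a , b , c) →
          ≈-trans (≈-sym p′) a , ≈-trans (≈-sym q′) b , proj₁ <-resp-≈ q (proj₂ <-resp-≈ p c)
      }
      where
      open CommutativeRing (RealNumbers.commutativeRing R) using ()
        renaming (trans to ≈-trans; sym to ≈-sym)
      open IsStrictPartialOrder (RealNumbers.isStrictPartialOrder R) using (<-resp-≈)

  record Signature : Set (lsuc ℓ) where
    field
      𝒲          : QuantumStructure
      Prop       : Set ℓ
      ClosedProp : Pred Prop ℓ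

    Σ_𝒲 : FOSignature
    Σ_𝒲 = QuantumStructure.signature 𝒲

    E_𝒲 : Pred (Atom Σ_𝒲) ℓ
    E_𝒲 e = QuantumStructure.structure 𝒲 ⊨ e
  open Signature

  record Morphism (Δ₁ Δ₂ : Signature) : Set (lsuc ℓ) where
    field
      foMorphism : FOMorphism (Σ_𝒲 Δ₁) (Σ_𝒲 Δ₂)
    open FOMorphism foMorphism public
    field
      E-entailed  : E_𝒲 Δ₂ ⊨ᴱ Image onAtom (E_𝒲 Δ₁)
      onProp      : Prop Δ₁ → Prop Δ₂
      onProp-closed : ∀ {p} → p ∈ ClosedProp Δ₁ → onProp p ∈ ClosedProp Δ₂

------------------------------------------------------------------------
-- Sentences

  infixl 7 _⨾_
  infixl 6 _⊔_
  infix  8 _*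

  data Action (Δ : Signature) : Set ℓ where
    unitary : U (Σ_𝒲 Δ) → Action Δ
    measure : Q (Σ_𝒲 Δ) → Action Δ
    _⨾_ _⊔_ : Action Δ → Action Δ → Action Δ
    _*      : Action Δ → Action Δ

  infixr 6 _∧_
  infixr 5 _⇒_ _↝_
  infix  7 ¬ˢ_ ∼_ [_]_ ↓_

  data Sentence (Δ : Signature) (n : ℕ) : Set ℓ where
    prop : Prop Δ → Sentence Δ n
    at   : Term (Σ_𝒲 Δ) n 𝕧 → Sentence Δ n → Sentence Δ n
    _∧_  : Sentence Δ n → Sentence Δ n → Sentence Δ n
    ¬ˢ_  : Sentence Δ n → Sentence Δ n
    ∼_   : Sentence Δ n → Sentence Δ n
    [_]_ : Action Δ → Sentence Δ n → Sentence Δ n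
    ↓_   : Sentence Δ (suc n) → Sentence Δ n

  _⇒_ _↝_ : ∀ {Δ n} → Sentence Δ n → Sentence Δ n → Sentence Δ n
  φ ⇒ γ   = ¬ˢ (φ ∧ ¬ˢ γ)
  ρ₁ ↝ ρ₂ = ∼ (ρ₁ ∧ ∼ (ρ₁ ∧ ρ₂))

  GroundTerm : Signature → Set ℓ
  GroundTerm Δ = Term (Σ_𝒲 Δ) 0 𝕧

  SentenceSet : Signature → Set (lsuc ℓ)
  SentenceSet Δ = Pred (Sentence Δ 0) ℓ

  substSentence : ∀ {Δ m n} → (Fin m → Term (Σ_𝒲 Δ) n 𝕧) → Sentence Δ m → Sentence Δ n
  substSentence σ (prop p)  = prop p
  substSentence σ (at k γ)  = at (substTerm σ k) (substSentence σ γ)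
  substSentence σ (γ ∧ γ′)  = substSentence σ γ ∧ substSentence σ γ′
  substSentence σ (¬ˢ γ)    = ¬ˢ substSentence σ γ
  substSentence σ (∼ γ)     = ∼ substSentence σ γ
  substSentence σ ([ 𝔞 ] γ) = [ 𝔞 ] substSentence σ γ
  substSentence σ (↓ γ)     = ↓ substSentence (extend σ) γ

  _[z←_] : ∀ {Δ} → Sentence Δ 1 → GroundTerm Δ → Sentence Δ 0
  γ [z← k ] = substSentence (λ _ → k) γ

  module Translation {Δ₁ Δ₂ : Signature} (χ : Morphism Δ₁ Δ₂) where
    open Morphism χ

    onAction : Action Δ₁ → Action Δ₂
    onAction (unitary u) = unitary (onU u)
    onAction (measure q) = measure (onQ q)
    onAction (𝔞 ⨾ 𝔟)     = onAction 𝔞 ⨾ onAction 𝔟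
    onAction (𝔞 ⊔ 𝔟)     = onAction 𝔞 ⊔ onAction 𝔟
    onAction (𝔞 *)       = onAction 𝔞 *

    onSentence : ∀ {n} → Sentence Δ₁ n → Sentence Δ₂ n
    onSentence (prop p)  = prop (onProp p)
    onSentence (at k γ)  = at (onTerm k) (onSentence γ)
    onSentence (γ ∧ γ′)  = onSentence γ ∧ onSentence γ′
    onSentence (¬ˢ γ)    = ¬ˢ onSentence γ
    onSentence (∼ γ)     = ∼ onSentence γ
    onSentence ([ 𝔞 ] γ) = [ onAction 𝔞 ] onSentence γ
    onSentence (↓ γ)     = ↓ onSentence γ

  data MeasurementFree {Δ} : Pred (Action Δ) ℓ where
    unitary : ∀ u → MeasurementFree (unitary u)
    _⨾_     : ∀ {𝔞 𝔟} → MeasurementFree 𝔞 → MeasurementFree 𝔟 → MeasurementFree (𝔞 ⨾ 𝔟)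
    _⊔_     : ∀ {𝔞 𝔟} → MeasurementFree 𝔞 → MeasurementFree 𝔟 → MeasurementFree (𝔞 ⊔ 𝔟)
    _*      : ∀ {𝔞} → MeasurementFree 𝔞 → MeasurementFree (𝔞 *)

  data Closed {Δ n} : Pred (Sentence Δ n) ℓ where
    prop : ∀ {r} → r ∈ ClosedProp Δ → Closed (prop r)
    ∼_   : ∀ {ρ} → Closed ρ → Closed (∼ ρ)
    _∧_  : ∀ {ρ₁ ρ₂} → Closed ρ₁ → Closed ρ₂ → Closed (ρ₁ ∧ ρ₂)
    [_]_ : ∀ {𝔟 ρ} → MeasurementFree 𝔟 → Closed ρ → Closed ([ 𝔟 ] ρ)

  data Basic {Δ} : ∀ {n} → Pred (Sentence Δ n) ℓ where
    prop : ∀ {n} p → Basic {n = n} (prop p)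
    _∧_  : ∀ {n} {φ φ′ : Sentence Δ n} → Basic φ → Basic φ′ → Basic (φ ∧ φ′)
    at   : ∀ {n} k {φ : Sentence Δ n} → Basic φ → Basic (at k φ)
    [_]_ : ∀ {n} 𝔞 {φ : Sentence Δ n} → Basic φ → Basic ([ 𝔞 ] φ)
    ↓_   : ∀ {n} {φ : Sentence Δ (suc n)} → Basic φ → Basic (↓ φ)

  data QuantumClause {Δ} : ∀ {n} → Pred (Sentence Δ n) ℓ where
    prop : ∀ {n} p → QuantumClause {n = n} (prop p)
    hook : ∀ {n} {ρ₁ ρ₂ : Sentence Δ n} → Closed ρ₁ → Basic ρ₁ →
           Closed ρ₂ → QuantumClause ρ₂ → QuantumClause (ρ₁ ↝ ρ₂)
    impl : ∀ {n} {φ γ : Sentence Δ n} → Basic φ → QuantumClause γ → QuantumClause (φ ⇒ γ)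
    _∧_  : ∀ {n} {γ γ′ : Sentence Δ n} →
           QuantumClause γ → QuantumClause γ′ → QuantumClause (γ ∧ γ′)
    at   : ∀ {n} k {γ : Sentence Δ n} → QuantumClause γ → QuantumClause (at k γ)
    [_]_ : ∀ {n} 𝔞 {γ : Sentence Δ n} → QuantumClause γ → QuantumClause ([ 𝔞 ] γ)
    ↓_   : ∀ {n} {γ : Sentence Δ (suc n)} → QuantumClause γ → QuantumClause (↓ γ)

------------------------------------------------------------------------
-- Fragments

  data SentenceOperator : Set where
    retrieve conjunction negation complement necessity store implication quantumImplication
      : SentenceOperator

  data ActionOperator : Set where
    composition union star : ActionOperator

  -- Any class of morphisms is allowed; closure under identities and
  -- composition is not needed.

  record Fragment : Set (lsuc (lsuc ℓ)) where
    field
      signatures        : Pred Signature (lsuc ℓ)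
      morphisms         : ∀ {Δ₁ Δ₂} → Pred (Morphism Δ₁ Δ₂) (lsuc ℓ)
      morphisms-scalars : ∀ {Δ₁ Δ₂} {χ : Morphism Δ₁ Δ₂} → χ ∈ morphisms →
                          ∀ z → Morphism.onC χ z ≡ scalar z
      sentenceOperators : Pred SentenceOperator 0ℓ
      actionOperators   : Pred ActionOperator 0ℓ
      retrieve-present  :
        (implication ∈ sentenceOperators ⊎ quantumImplication ∈ sentenceOperators) →
        retrieve ∈ sentenceOperators
  open Fragment

  data ActionOf (𝓛 : Fragment) {Δ} : Pred (Action Δ) ℓ where
    unitary : ∀ u → ActionOf 𝓛 (unitary u)
    measure : ∀ q → ActionOf 𝓛 (measure q)
    comp    : ∀ {𝔞 𝔟} → composition ∈ actionOperators 𝓛 →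
              ActionOf 𝓛 𝔞 → ActionOf 𝓛 𝔟 → ActionOf 𝓛 (𝔞 ⨾ 𝔟)
    union   : ∀ {𝔞 𝔟} → union ∈ actionOperators 𝓛 →
              ActionOf 𝓛 𝔞 → ActionOf 𝓛 𝔟 → ActionOf 𝓛 (𝔞 ⊔ 𝔟)
    star    : ∀ {𝔞} → star ∈ actionOperators 𝓛 → ActionOf 𝓛 𝔞 → ActionOf 𝓛 (𝔞 *)

  -- Although ⇒ and ↝ abbreviate other sentences, a fragment may contain
  -- them without containing the connectives that they are defined from.

  data SentenceOf (𝓛 : Fragment) {Δ} : ∀ {n} → Pred (Sentence Δ n) ℓ where
    prop  : ∀ {n} p → SentenceOf 𝓛 {n = n} (prop p)
    at    : ∀ {n} k {γ : Sentence Δ n} → retrieve ∈ sentenceOperators 𝓛 →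
            SentenceOf 𝓛 γ → SentenceOf 𝓛 (at k γ)
    conj  : ∀ {n} {γ γ′ : Sentence Δ n} → conjunction ∈ sentenceOperators 𝓛 →
            SentenceOf 𝓛 γ → SentenceOf 𝓛 γ′ → SentenceOf 𝓛 (γ ∧ γ′)
    neg   : ∀ {n} {γ : Sentence Δ n} → negation ∈ sentenceOperators 𝓛 →
            SentenceOf 𝓛 γ → SentenceOf 𝓛 (¬ˢ γ)
    compl : ∀ {n} {γ : Sentence Δ n} → complement ∈ sentenceOperators 𝓛 →
            SentenceOf 𝓛 γ → SentenceOf 𝓛 (∼ γ)
    nec   : ∀ {n 𝔞} {γ : Sentence Δ n} → necessity ∈ sentenceOperators 𝓛 →
            ActionOf 𝓛 𝔞 → SentenceOf 𝓛 γ → SentenceOf 𝓛 ([ 𝔞 ] γ)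
    store : ∀ {n} {γ : Sentence Δ (suc n)} → store ∈ sentenceOperators 𝓛 →
            SentenceOf 𝓛 γ → SentenceOf 𝓛 (↓ γ)
    impl  : ∀ {n} {φ γ : Sentence Δ n} → implication ∈ sentenceOperators 𝓛 →
            SentenceOf 𝓛 φ → SentenceOf 𝓛 γ → SentenceOf 𝓛 (φ ⇒ γ)
    hook  : ∀ {n} {ρ₁ ρ₂ : Sentence Δ n} → quantumImplication ∈ sentenceOperators 𝓛 →
            Closed ρ₁ → Closed ρ₂ →
            SentenceOf 𝓛 ρ₁ → SentenceOf 𝓛 ρ₂ → SentenceOf 𝓛 (ρ₁ ↝ ρ₂)

  NoClosedPropositions : Fragment → Set (lsuc ℓ)
  NoClosedPropositions 𝓛 = ∀ {Δ} → Δ ∈ signatures 𝓛 → ∀ p → ¬ (p ∈ ClosedProp Δ)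

  StarFree : Fragment → Set
  StarFree 𝓛 = ¬ (star ∈ actionOperators 𝓛)

------------------------------------------------------------------------
-- The least entailment system closed under the proof rules

  -- Side conditions SentenceOf and _⊆ SentenceOf keep every judgement
  -- within the fragment; they are stated only where a rule introduces
  -- a sentence that its premises do not already force to be in it.
  -- Since sets are predicates, extensionality is a rule.  There are no
  -- rules for _*, as the system is meant for star-free fragments.

  infix 3 _∣_⊢[_]_

  data _∣_⊢[_]_ (𝓛 : Fragment) :
    ∀ {Δ} → SentenceSet Δ → GroundTerm Δ → Sentence Δ 0 → Set (lsuc ℓ) where

    monotonicity : ∀ {Δ} {Γ : SentenceSet Δ} {k γ} →
      Δ ∈ signatures 𝓛 → Γ ⊆ SentenceOf 𝓛 → γ ∈ Γ → 𝓛 ∣ Γ ⊢[ k ] γ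
    unions : ∀ {Δ} {Γ Γ′ : SentenceSet Δ} {k γ} →
      Γ′ ⊆ SentenceOf 𝓛 → 𝓛 ∣ Γ ⊢[ k ] γ → 𝓛 ∣ Γ ∪ Γ′ ⊢[ k ] γ
    extensionality : ∀ {Δ} {Γ Γ′ : SentenceSet Δ} {k γ} →
      Γ ≐ Γ′ → 𝓛 ∣ Γ ⊢[ k ] γ → 𝓛 ∣ Γ′ ⊢[ k ] γ
    translation : ∀ {Δ₁ Δ₂} (χ : Morphism Δ₁ Δ₂) {Γ : SentenceSet Δ₁} {k γ} →
      let open Morphism χ; open Translation χ in
      Δ₂ ∈ signatures 𝓛 → χ ∈ morphisms 𝓛 →
      𝓛 ∣ Γ ⊢[ k ] γ → 𝓛 ∣ Image onSentence Γ ⊢[ onTerm k ] onSentence γ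

    equation : ∀ {Δ} {Γ : SentenceSet Δ} {k₁ k₂ γ} →
      (k₁ ≈ᵃ k₂) ∈ E_𝒲 Δ → 𝓛 ∣ Γ ⊢[ k₁ ] γ → 𝓛 ∣ Γ ⊢[ k₂ ] γ
    at-intro : ∀ {Δ} {Γ : SentenceSet Δ} {k₁ k₂ γ} →
      SentenceOf 𝓛 (at k₁ γ) → 𝓛 ∣ Γ ⊢[ k₁ ] γ → 𝓛 ∣ Γ ⊢[ k₂ ] at k₁ γ
    at-elim : ∀ {Δ} {Γ : SentenceSet Δ} {k₁ k₂ γ} →
      𝓛 ∣ Γ ⊢[ k₂ ] at k₁ γ → 𝓛 ∣ Γ ⊢[ k₁ ] γ
    ↓-intro : ∀ {Δ} {Γ : SentenceSet Δ} {k γ} →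
      SentenceOf 𝓛 (↓ γ) → 𝓛 ∣ Γ ⊢[ k ] γ [z← k ] → 𝓛 ∣ Γ ⊢[ k ] ↓ γ
    ↓-elim : ∀ {Δ} {Γ : SentenceSet Δ} {k γ} →
      𝓛 ∣ Γ ⊢[ k ] ↓ γ → 𝓛 ∣ Γ ⊢[ k ] γ [z← k ]
    ∧-intro : ∀ {Δ} {Γ : SentenceSet Δ} {k γ₁ γ₂} →
      SentenceOf 𝓛 (γ₁ ∧ γ₂) → 𝓛 ∣ Γ ⊢[ k ] γ₁ → 𝓛 ∣ Γ ⊢[ k ] γ₂ → 𝓛 ∣ Γ ⊢[ k ] γ₁ ∧ γ₂
    ∧-elim₁ : ∀ {Δ} {Γ : SentenceSet Δ} {k γ₁ γ₂} →
      𝓛 ∣ Γ ⊢[ k ] γ₁ ∧ γ₂ → 𝓛 ∣ Γ ⊢[ k ] γ₁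
    ∧-elim₂ : ∀ {Δ} {Γ : SentenceSet Δ} {k γ₁ γ₂} →
      𝓛 ∣ Γ ⊢[ k ] γ₁ ∧ γ₂ → 𝓛 ∣ Γ ⊢[ k ] γ₂

    unitary-intro : ∀ {Δ} {Γ : SentenceSet Δ} {u k γ} →
      SentenceOf 𝓛 ([ unitary u ] γ) →
      𝓛 ∣ Γ ⊢[ app (unitary u) (k ∷ []) ] γ → 𝓛 ∣ Γ ⊢[ k ] [ unitary u ] γ
    unitary-elim : ∀ {Δ} {Γ : SentenceSet Δ} {u k γ} →
      𝓛 ∣ Γ ⊢[ k ] [ unitary u ] γ → 𝓛 ∣ Γ ⊢[ app (unitary u) (k ∷ []) ] γ
    measure-intro : ∀ {Δ} {Γ : SentenceSet Δ} {q k γ} →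
      SentenceOf 𝓛 ([ measure q ] γ) →
      𝓛 ∣ Γ ⊢[ app (measure q) (k ∷ []) ] γ → 𝓛 ∣ Γ ⊢[ k ] [ measure q ] γ
    measure-elim : ∀ {Δ} {Γ : SentenceSet Δ} {q k γ} →
      𝓛 ∣ Γ ⊢[ k ] [ measure q ] γ → 𝓛 ∣ Γ ⊢[ app (measure q) (k ∷ []) ] γ
    ⨾-intro : ∀ {Δ} {Γ : SentenceSet Δ} {k 𝔞₁ 𝔞₂ γ} →
      SentenceOf 𝓛 ([ 𝔞₁ ⨾ 𝔞₂ ] γ) →
      𝓛 ∣ Γ ⊢[ k ] [ 𝔞₁ ] [ 𝔞₂ ] γ → 𝓛 ∣ Γ ⊢[ k ] [ 𝔞₁ ⨾ 𝔞₂ ] γ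
    ⨾-elim : ∀ {Δ} {Γ : SentenceSet Δ} {k 𝔞₁ 𝔞₂ γ} →
      𝓛 ∣ Γ ⊢[ k ] [ 𝔞₁ ⨾ 𝔞₂ ] γ → 𝓛 ∣ Γ ⊢[ k ] [ 𝔞₁ ] [ 𝔞₂ ] γ
    ⊔-intro : ∀ {Δ} {Γ : SentenceSet Δ} {k 𝔞₁ 𝔞₂ γ} →
      SentenceOf 𝓛 ([ 𝔞₁ ⊔ 𝔞₂ ] γ) →
      𝓛 ∣ Γ ⊢[ k ] [ 𝔞₁ ] γ → 𝓛 ∣ Γ ⊢[ k ] [ 𝔞₂ ] γ → 𝓛 ∣ Γ ⊢[ k ] [ 𝔞₁ ⊔ 𝔞₂ ] γ
    ⊔-elim₁ : ∀ {Δ} {Γ : SentenceSet Δ} {k 𝔞₁ 𝔞₂ γ} →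
      𝓛 ∣ Γ ⊢[ k ] [ 𝔞₁ ⊔ 𝔞₂ ] γ → 𝓛 ∣ Γ ⊢[ k ] [ 𝔞₁ ] γ
    ⊔-elim₂ : ∀ {Δ} {Γ : SentenceSet Δ} {k 𝔞₁ 𝔞₂ γ} →
      𝓛 ∣ Γ ⊢[ k ] [ 𝔞₁ ⊔ 𝔞₂ ] γ → 𝓛 ∣ Γ ⊢[ k ] [ 𝔞₂ ] γ

    ⇒-elim : ∀ {Δ} {Γ : SentenceSet Δ} {k φ γ} → Basic φ →
      𝓛 ∣ Γ ⊢[ k ] φ ⇒ γ → 𝓛 ∣ Γ ⊢[ k ] φ → 𝓛 ∣ Γ ⊢[ k ] γ
    ↝-elim : ∀ {Δ} {Γ : SentenceSet Δ} {k ρ₁ ρ₂} →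
      Closed ρ₁ → Basic ρ₁ → Closed ρ₂ → QuantumClause ρ₂ →
      𝓛 ∣ Γ ⊢[ k ] ρ₁ ↝ ρ₂ → 𝓛 ∣ Γ ⊢[ k ] ρ₁ → 𝓛 ∣ Γ ⊢[ k ] ρ₂
    ⇒-intro : ∀ {Δ} {Γ : SentenceSet Δ} {k φ γ} → Basic φ →
      SentenceOf 𝓛 (φ ⇒ γ) →
      𝓛 ∣ Γ ∪ ｛ at k φ ｝ ⊢[ k ] γ → 𝓛 ∣ Γ ⊢[ k ] φ ⇒ γ
    ↝-intro : ∀ {Δ} {Γ : SentenceSet Δ} {k ρ₁ ρ₂} →
      Closed ρ₁ → Basic ρ₁ → Closed ρ₂ → QuantumClause ρ₂ →
      SentenceOf 𝓛 (ρ₁ ↝ ρ₂) →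
      𝓛 ∣ Γ ∪ ｛ at k ρ₁ ｝ ⊢[ k ] ρ₂ → 𝓛 ∣ Γ ⊢[ k ] ρ₁ ↝ ρ₂

  Finite : {A : Set ℓ} → Pred A ℓ → Set ℓ
  Finite S = ∃[ xs ] S ≐ (List._∈ xs)

{-# OPTIONS --safe #-}

-- A derivation is finite and uses its context only at the leaves, so by
-- induction on derivations each one uses finitely many hypotheses.  At the
-- branching rules the hypotheses are merged by weakening.  At the implication
-- rules the discharged hypothesis is removed from the list obtained for the
-- premise.

module Submission where

open import Data.List.Base using (List; []; _∷_; _++_; map)
open import Data.List.Membership.Propositional using () renaming (_∈_ to _∈ˡ_)
open import Data.List.Membership.Propositional.Properties
  using (∈-++⁺ˡ; ∈-++⁺ʳ; ∈-map⁺; ∈-map⁻)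
open import Data.List.Relation.Unary.All as All using (All; []; _∷_)
open import Data.List.Relation.Unary.All.Properties using (++⁺; map⁺)
open import Data.List.Relation.Unary.Any using (here; there)
open import Data.Product.Base using (_×_; ∃-syntax; _,_; proj₁; proj₂; map₂)
open import Data.Sum.Base using (inj₁; inj₂; [_,_]; map₁)
open import Function.Base using (id)
open import Level using (Level)
open import Relation.Binary.PropositionalEquality using (refl)
open import Relation.Unary using (Pred; _∈_; _⊆_; _∪_; ｛_｝)
open import Defs

private variable
  a p : Level

-- Each entry carries evidence for one side of the union, and this evidence alone decides whether
-- the entry is kept, so no decidable equality on `A` is required. An entry equal to `x` may stay in
-- `ys` if its evidence is on the side of `P`.
separate : {A : Set a} {P : Pred A p} {x : A} {xs : List A} → All (P ∪ ｛ x ｝) xs →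
  ∃[ ys ] All P ys × (_∈ˡ xs) ⊆ (_∈ˡ ys) ∪ ｛ x ｝
separate [] = [] , [] , λ ()
separate (inj₁ y∈P ∷ xs⊆) with ys , ys⊆P , xs⊆ys ← separate xs⊆ =
  _ ∷ ys , y∈P ∷ ys⊆P , λ where
    (here refl)  → inj₁ (here refl)
    (there z∈xs) → map₁ there (xs⊆ys z∈xs)
separate (inj₂ refl ∷ xs⊆) with ys , ys⊆P , xs⊆ys ← separate xs⊆ =
  ys , ys⊆P , λ where
    (here refl)  → inj₂ refl
    (there z∈xs) → xs⊆ys z∈xs

module _ {ℓ} (R : RealNumbers ℓ) (Fᶜ : ScalarOperations R) where
  open HDQL R Fᶜ

  module _ {Δ₁ Δ₂ : Signature} (χ : Morphism Δ₁ Δ₂) where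
    open Morphism χ
    open Translation χ

    onAction-MeasurementFree : ∀ {𝔞} → MeasurementFree 𝔞 → MeasurementFree (onAction 𝔞)
    onAction-MeasurementFree (unitary u) = unitary (onU u)
    onAction-MeasurementFree (m ⨾ n)     = onAction-MeasurementFree m ⨾ onAction-MeasurementFree n
    onAction-MeasurementFree (m ⊔ n)     = onAction-MeasurementFree m ⊔ onAction-MeasurementFree n
    onAction-MeasurementFree (m *)       = onAction-MeasurementFree m *

    onSentence-Closed : ∀ {n} {ρ : Sentence Δ₁ n} → Closed ρ → Closed (onSentence ρ)
    onSentence-Closed (prop r)  = prop (onProp-closed r)
    onSentence-Closed (∼ c)     = ∼ onSentence-Closed c
    onSentence-Closed (c ∧ d)   = onSentence-Closed c ∧ onSentence-Closed d
    onSentence-Closed ([ m ] c) = [ onAction-MeasurementFree m ] onSentence-Closed c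

    module _ {𝓛 : Fragment} where

      onAction-ActionOf : ∀ {𝔞} → ActionOf 𝓛 𝔞 → ActionOf 𝓛 (onAction 𝔞)
      onAction-ActionOf (unitary u)   = unitary (onU u)
      onAction-ActionOf (measure q)   = measure (onQ q)
      onAction-ActionOf (comp o a b)  = comp o (onAction-ActionOf a) (onAction-ActionOf b)
      onAction-ActionOf (union o a b) = union o (onAction-ActionOf a) (onAction-ActionOf b)
      onAction-ActionOf (star o a)    = star o (onAction-ActionOf a)

      -- Translation keeps the operators of a sentence, and it keeps the operands of a hook closed
      -- because morphisms send closed propositional symbols to closed ones. This puts translated
      -- contexts back in the fragment.
      onSentence-SentenceOf : ∀ {n} {γ : Sentence Δ₁ n} →
        SentenceOf 𝓛 γ → SentenceOf 𝓛 (onSentence γ)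
      onSentence-SentenceOf (prop p)    = prop (onProp p)
      onSentence-SentenceOf (at k o s)  = at (onTerm k) o (onSentence-SentenceOf s)
      onSentence-SentenceOf (conj o s t) =
        conj o (onSentence-SentenceOf s) (onSentence-SentenceOf t)
      onSentence-SentenceOf (neg o s)   = neg o (onSentence-SentenceOf s)
      onSentence-SentenceOf (compl o s) = compl o (onSentence-SentenceOf s)
      onSentence-SentenceOf (nec o a s) = nec o (onAction-ActionOf a) (onSentence-SentenceOf s)
      onSentence-SentenceOf (store o s) = store o (onSentence-SentenceOf s)
      onSentence-SentenceOf (impl o s t) =
        impl o (onSentence-SentenceOf s) (onSentence-SentenceOf t)
      onSentence-SentenceOf (hook o c d s t) =
        hook o (onSentence-Closed c) (onSentence-Closed d)
          (onSentence-SentenceOf s) (onSentence-SentenceOf t)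

  module _ {𝓛 : Fragment} where

    -- Hypotheses enter a derivation only at leaves and through `unions`, where a side condition
    -- places them in the fragment. This supplies the side conditions of the later weakenings.
    context-SentenceOf : ∀ {Δ} {Γ : SentenceSet Δ} {k γ} →
      𝓛 ∣ Γ ⊢[ k ] γ → Γ ⊆ SentenceOf 𝓛
    context-SentenceOf (monotonicity _ Γ⊆ _) = Γ⊆
    context-SentenceOf (unions Γ′⊆ d) = [ context-SentenceOf d , Γ′⊆ ]
    context-SentenceOf (extensionality Γ≐Γ′ d) x∈Γ′ = context-SentenceOf d (proj₂ Γ≐Γ′ x∈Γ′)
    context-SentenceOf (translation χ _ _ d) (_ , x∈Γ , refl) =
      onSentence-SentenceOf χ (context-SentenceOf d x∈Γ)
    context-SentenceOf (equation _ d)        = context-SentenceOf d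
    context-SentenceOf (at-intro _ d)        = context-SentenceOf d
    context-SentenceOf (at-elim d)           = context-SentenceOf d
    context-SentenceOf (↓-intro _ d)         = context-SentenceOf d
    context-SentenceOf (↓-elim d)            = context-SentenceOf d
    context-SentenceOf (∧-intro _ d _)       = context-SentenceOf d
    context-SentenceOf (∧-elim₁ d)           = context-SentenceOf d
    context-SentenceOf (∧-elim₂ d)           = context-SentenceOf d
    context-SentenceOf (unitary-intro _ d)   = context-SentenceOf d
    context-SentenceOf (unitary-elim d)      = context-SentenceOf d
    context-SentenceOf (measure-intro _ d)   = context-SentenceOf d
    context-SentenceOf (measure-elim d)      = context-SentenceOf d
    context-SentenceOf (⨾-intro _ d)         = context-SentenceOf d
    context-SentenceOf (⨾-elim d)            = context-SentenceOf d
    context-SentenceOf (⊔-intro _ d _)       = context-SentenceOf d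
    context-SentenceOf (⊔-elim₁ d)           = context-SentenceOf d
    context-SentenceOf (⊔-elim₂ d)           = context-SentenceOf d
    context-SentenceOf (⇒-elim _ d _)        = context-SentenceOf d
    context-SentenceOf (↝-elim _ _ _ _ d _)  = context-SentenceOf d
    context-SentenceOf (⇒-intro _ _ d) x∈Γ   = context-SentenceOf d (inj₁ x∈Γ)
    context-SentenceOf (↝-intro _ _ _ _ _ d) x∈Γ = context-SentenceOf d (inj₁ x∈Γ)

    -- When `Γ ⊆ Γ′`, the union `Γ ∪ Γ′` has the same elements as `Γ′`.
    weaken : ∀ {Δ} {Γ Γ′ : SentenceSet Δ} {k γ} →
      Γ ⊆ Γ′ → Γ′ ⊆ SentenceOf 𝓛 → 𝓛 ∣ Γ ⊢[ k ] γ → 𝓛 ∣ Γ′ ⊢[ k ] γ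
    weaken Γ⊆Γ′ Γ′⊆ d = extensionality ([ Γ⊆Γ′ , id ] , inj₂) (unions Γ′⊆ d)

    infix 3 _⊢ᶠ[_]_
    -- Finite subsets are represented by lists, so that merging two of them is concatenation and
    -- translating one is `map`.
    _⊢ᶠ[_]_ : ∀ {Δ} → SentenceSet Δ → GroundTerm Δ → Sentence Δ 0 → Set _
    Γ ⊢ᶠ[ k ] γ = ∃[ xs ] All (_∈ Γ) xs × (𝓛 ∣ (_∈ˡ xs) ⊢[ k ] γ)

    module _ {Δ} {Γ : SentenceSet Δ} where

      -- The rule is required for every context because it is applied over the concatenated list
      -- rather than over `Γ`.
      binary : ∀ {k k₁ k₂ γ γ₁ γ₂} →
        (∀ {Γ′} → 𝓛 ∣ Γ′ ⊢[ k₁ ] γ₁ → 𝓛 ∣ Γ′ ⊢[ k₂ ] γ₂ → 𝓛 ∣ Γ′ ⊢[ k ] γ) →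
        Γ ⊢ᶠ[ k₁ ] γ₁ → Γ ⊢ᶠ[ k₂ ] γ₂ → Γ ⊢ᶠ[ k ] γ
      binary rule (xs , xs⊆Γ , d) (ys , ys⊆Γ , e) =
        xs ++ ys , ++⁺ xs⊆Γ ys⊆Γ , rule (weaken ∈-++⁺ˡ ++⊆ d) (weaken (∈-++⁺ʳ xs) ++⊆ e)
        where
        ++⊆ : (_∈ˡ xs ++ ys) ⊆ SentenceOf 𝓛
        ++⊆ = All.lookup (++⁺ (All.tabulate (context-SentenceOf d))
                              (All.tabulate (context-SentenceOf e)))

      -- The premise is weakened to `ys` together with `φ`, whether or not `φ` was used, so that its
      -- context has the shape the rule expects. The bound on `Γ ∪ ｛ φ ｝` ensures that `φ` itself
      -- lies in the fragment.
      discharge : ∀ {k k′ φ γ γ′} → (Γ ∪ ｛ φ ｝) ⊆ SentenceOf 𝓛 →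
        (∀ {Γ′} → 𝓛 ∣ Γ′ ∪ ｛ φ ｝ ⊢[ k ] γ → 𝓛 ∣ Γ′ ⊢[ k′ ] γ′) →
        (Γ ∪ ｛ φ ｝) ⊢ᶠ[ k ] γ → Γ ⊢ᶠ[ k′ ] γ′
      discharge Γφ⊆ rule (xs , xs⊆ , d) with ys , ys⊆Γ , xs⊆ys ← separate xs⊆ =
        ys , ys⊆Γ ,
        rule (weaken xs⊆ys (λ z∈ → Γφ⊆ (map₁ (All.lookup ys⊆Γ) z∈)) d)

    compact : ∀ {Δ} {Γ : SentenceSet Δ} {k γ} → 𝓛 ∣ Γ ⊢[ k ] γ → Γ ⊢ᶠ[ k ] γ
    compact {γ = γ} (monotonicity Δ∈ Γ⊆ γ∈Γ) =
      γ ∷ [] , γ∈Γ ∷ [] , monotonicity Δ∈ (λ { (here refl) → Γ⊆ γ∈Γ }) (here refl)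
    -- The added hypotheses are dropped: the list and its derivation stay, and only the membership
    -- evidence is moved to the union.
    compact (unions _ d) with xs , xs⊆Γ , e ← compact d = xs , All.map inj₁ xs⊆Γ , e
    compact (extensionality Γ≐Γ′ d) with xs , xs⊆Γ , e ← compact d =
      xs , All.map (proj₁ Γ≐Γ′) xs⊆Γ , e
    compact (translation χ Δ₂∈ χ∈ d) with xs , xs⊆Γ , e ← compact d =
      map onSentence xs ,
      map⁺ (All.map (λ x∈Γ → _ , x∈Γ , refl) xs⊆Γ) ,
      -- The translation rule yields the image of the membership predicate of `xs`, which has the
      -- same elements as the mapped list.
      extensionality ((λ { (_ , x∈xs , refl) → ∈-map⁺ onSentence x∈xs }) , ∈-map⁻ onSentence)
        (translation χ Δ₂∈ χ∈ e)
      where open Translation χ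
    compact (equation k₁≈k₂ d)    = map₂ (map₂ (equation k₁≈k₂)) (compact d)
    compact (at-intro s d)        = map₂ (map₂ (at-intro s)) (compact d)
    compact (at-elim d)           = map₂ (map₂ at-elim) (compact d)
    compact (↓-intro s d)         = map₂ (map₂ (↓-intro s)) (compact d)
    compact (↓-elim d)            = map₂ (map₂ ↓-elim) (compact d)
    compact (∧-intro s d e)       = binary (∧-intro s) (compact d) (compact e)
    compact (∧-elim₁ d)           = map₂ (map₂ ∧-elim₁) (compact d)
    compact (∧-elim₂ d)           = map₂ (map₂ ∧-elim₂) (compact d)
    compact (unitary-intro s d)   = map₂ (map₂ (unitary-intro s)) (compact d)
    compact (unitary-elim d)      = map₂ (map₂ unitary-elim) (compact d)
    compact (measure-intro s d)   = map₂ (map₂ (measure-intro s)) (compact d)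
    compact (measure-elim d)      = map₂ (map₂ measure-elim) (compact d)
    compact (⨾-intro s d)         = map₂ (map₂ (⨾-intro s)) (compact d)
    compact (⨾-elim d)            = map₂ (map₂ ⨾-elim) (compact d)
    compact (⊔-intro s d e)       = binary (⊔-intro s) (compact d) (compact e)
    compact (⊔-elim₁ d)           = map₂ (map₂ ⊔-elim₁) (compact d)
    compact (⊔-elim₂ d)           = map₂ (map₂ ⊔-elim₂) (compact d)
    compact (⇒-elim b d e)        = binary (⇒-elim b) (compact d) (compact e)
    compact (↝-elim c b c′ q d e) = binary (↝-elim c b c′ q) (compact d) (compact e)
    compact (⇒-intro b s d)       =
      -- The bound comes from the original premise `d`, whose context contains the discharged
      -- sentence even when the extracted list omits it.
      discharge (context-SentenceOf d) (⇒-intro b s) (compact d)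
    compact (↝-intro c b c′ q s d) =
      discharge (context-SentenceOf d) (↝-intro c b c′ q s) (compact d)

proposition4p7 : ∀ {ℓ} (R : RealNumbers ℓ) (Fᶜ : ScalarOperations R) →
    let open HDQL R Fᶜ in
    (𝓛 : Fragment) → NoClosedPropositions 𝓛 → StarFree 𝓛 →
    ∀ {Δ} → Δ ∈ Fragment.signatures 𝓛 →
    (Γ : SentenceSet Δ) → Γ ⊆ SentenceOf 𝓛 →
    (γ : Sentence Δ 0) → γ ∈ SentenceOf 𝓛 →
    (k : GroundTerm Δ) →
    𝓛 ∣ Γ ⊢[ k ] γ →
    ∃[ Γf ] Finite Γf × Γf ⊆ Γ × (𝓛 ∣ Γf ⊢[ k ] γ)
proposition4p7 R Fᶜ _ _ _ _ _ _ _ _ _ Γ⊢γ with xs , xs⊆Γ , d ← compact R Fᶜ Γ⊢γ =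
  (_∈ˡ xs) , (xs , id , id) , All.lookup xs⊆Γ , d
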